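{- If $G$ is a twin-free acyclic digraph of order $n$, then $\gamma_L(G)\leq\lceil\frac{n}{2}\rceil$.
   Context: Digraphs are loopless without multiple arcs; acyclic means no directed cycle. Two vertices are twins if they have the same open in-neighbourhood or the same closed in-neighbourhood. A dominating set is a set $D$ such that every vertex not in $D$ has an in-neighbour in $D$; it is locating-dominating if moreover every vertex not in $D$ has a distinct set of in-neighbours in $D$. $\gamma_L(G)$ is the minimum size of a locating-dominating set. -}

module Defs where

open import Data.Nat using (ℕ; _≤_)
open import Data.Fin using (Fin)
open import Data.Fin.Subset using (Subset; _∈_; _∉_; ∣_∣)
open import Data.Bool using (Bool; true)
open import Data.Product using (Σ; _×_; ∃)
open import Data.Sum using (_⊎_)
open import Relation.Nullary using (¬_)
open import Relation.Binary.PropositionalEquality using (_≡_; _≢_)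
open import Relation.Binary.Construct.Closure.Transitive using (TransClosure)
open import Function.Bundles using (_⇔_)

record Digraph (n : ℕ) : Set where
  field
    arc      : Fin n → Fin n → Bool
    loopless : ∀ v → ¬ (arc v v ≡ true)

module _ {n : ℕ} (G : Digraph n) where
  open Digraph G

  _⟶_ : Fin n → Fin n → Set
  u ⟶ v = arc u v ≡ true

  Acyclic : Set
  Acyclic = ∀ v → ¬ TransClosure _⟶_ v v

  SameOpenIn : Fin n → Fin n → Set
  SameOpenIn u v = ∀ w → (w ⟶ u) ⇔ (w ⟶ v)

  SameClosedIn : Fin n → Fin n → Set
  SameClosedIn u v = ∀ w → (w ⟶ u ⊎ w ≡ u) ⇔ (w ⟶ v ⊎ w ≡ v)

  Twins : Fin n → Fin n → Set
  Twins u v = SameOpenIn u v ⊎ SameClosedIn u v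

  TwinFree : Set
  TwinFree = ∀ u v → u ≢ v → ¬ Twins u v

  Dominating : Subset n → Set
  Dominating D = ∀ v → v ∉ D → ∃ λ u → u ∈ D × u ⟶ v

  SameInTrace : Subset n → Fin n → Fin n → Set
  SameInTrace D u v = ∀ w → w ∈ D → (w ⟶ u) ⇔ (w ⟶ v)

  LocatingDominating : Subset n → Set
  LocatingDominating D =
    Dominating D × (∀ u v → u ∉ D → v ∉ D → u ≢ v → ¬ SameInTrace D u v)

  γL≤ : ℕ → Set
  γL≤ k = Σ (Subset n) λ D → LocatingDominating D × ∣ D ∣ ≤ k

{-# OPTIONS --safe #-}

-- List the vertices in topological order as s, t, y₁, y₂, …; by twin-freeness
-- s is the only source and s is the only in-neighbour of t.  Scan the yᵢ from
-- the last to the first, keeping disjoint sets D (chosen) and R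
-- (representatives) of scanned vertices with ∣D∣ = ∣R∣, such that the vertices
-- of R ∪ {s, t} have distinct in-traces on D ∪ {s}.  A scanned vertex x joins D
-- exactly when this lets R gain a representative.  Since the vertices not yet
-- scanned have the same trace as s or t, two vertices outside D with the same
-- final trace have in-neighbourhoods that differ at most in t.  So
-- D ∪ {s, t} is locating-dominating, and so is D ∪ {s} if no vertex is left
-- outside D and R, which is the only case where D ∪ {s, t} is too large.

module Submission where

open import Defs
open import Data.Nat using (ℕ; zero; suc; ⌈_/2⌉; _+_; _≤_; z≤n; s≤s)
open import Data.Nat.Properties
  using (≤-refl; ≤-reflexive; ≤-trans; +-suc; +-assoc; +-monoʳ-≤; m≤m+n; m≤n⇒m≤1+n;
         n≡⌊n+n/2⌋; n≡⌈n+n/2⌉; ⌈n/2⌉-mono; suc-injective)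
open import Data.Fin using (Fin) renaming (_≟_ to _≟ᶠ_)
open import Data.Fin.Induction using (spo-wellFounded)
open import Data.Fin.Subset
  using (Subset; inside; outside; ⁅_⁆; _∪_; ⋃; ∣_∣) renaming (_∈_ to _∈ˢ_; _∉_ to _∉ˢ_)
open import Data.Fin.Subset.Properties
  using (∉⊥; ∣⊥∣≡0; x∈⁅x⁆; x∈⁅y⁆⇒x≡y; ∣⁅x⁆∣≡1; x∈p∪q⁺; x∈p∪q⁻)
open import Data.Vec using ([]; _∷_)
open import Data.Bool using (true; false; _≟_)
open import Data.Bool.Properties using (¬-not; ⇔→≡)
open import Data.List using (List; []; _∷_; _++_; length; map; allFin)
open import Data.List.Properties using (length-tabulate; length-++; ++-identityʳ)
open import Data.List.Membership.Propositional using (_∈_; _∉_; find; lose)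
open import Data.List.Membership.Propositional.Properties
  using (∈-∃++; ∈-allFin; ∈-++⁺ˡ; ∈-++⁻)
open import Data.List.Relation.Unary.Any using (here; there; any?)
open import Data.List.Relation.Unary.All as All using (All; []; _∷_; all?)
open import Data.List.Relation.Unary.All.Properties using (¬Any⇒All¬)
open import Data.List.Relation.Unary.AllPairs using (AllPairs; []; _∷_)
open import Data.List.Relation.Unary.Unique.Propositional using (Unique)
open import Data.List.Relation.Unary.Unique.Propositional.Properties using (allFin⁺)
open import Data.List.Relation.Binary.Permutation.Propositional
  using (_↭_; ↭-refl; ↭-sym; ↭-trans; prep; ↭⇒↭ₛ)
open import Data.List.Relation.Binary.Permutation.Propositional.Properties
  using (↭-length; ∈-resp-↭; ++⁺ˡ; shift)
import Data.List.Relation.Binary.Permutation.Setoid.Properties as ↭ₛ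
open import Data.Product using (_×_; _,_; ∃)
open import Data.Sum as Sum using (_⊎_; inj₁; inj₂; [_,_]′)
open import Data.Empty using (⊥-elim)
open import Function using (_∘_)
open import Function.Bundles using (mk⇔)
open import Induction.WellFounded using (WellFounded; Acc; acc)
open import Relation.Nullary using (¬_; Dec; yes; no; contradiction; ¬?)
open import Relation.Nullary.Decidable using (decidable-stable)
open import Relation.Binary using (IsStrictPartialOrder)
open import Relation.Binary.Construct.Closure.Transitive as Plus using (TransClosure)
open import Relation.Binary.PropositionalEquality

-- Subsets of `Fin n` given by lists.

∣p∪q∣≤∣p∣+∣q∣ : ∀ {n} (p q : Subset n) → ∣ p ∪ q ∣ ≤ ∣ p ∣ + ∣ q ∣
∣p∪q∣≤∣p∣+∣q∣ []            []            = z≤n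
∣p∪q∣≤∣p∣+∣q∣ (outside ∷ p) (outside ∷ q) = ∣p∪q∣≤∣p∣+∣q∣ p q
∣p∪q∣≤∣p∣+∣q∣ (outside ∷ p) (inside  ∷ q) =
  ≤-trans (s≤s (∣p∪q∣≤∣p∣+∣q∣ p q)) (≤-reflexive (sym (+-suc ∣ p ∣ ∣ q ∣)))
∣p∪q∣≤∣p∣+∣q∣ (inside  ∷ p) (outside ∷ q) = s≤s (∣p∪q∣≤∣p∣+∣q∣ p q)
∣p∪q∣≤∣p∣+∣q∣ (inside  ∷ p) (inside  ∷ q) =
  s≤s (≤-trans (∣p∪q∣≤∣p∣+∣q∣ p q) (+-monoʳ-≤ ∣ p ∣ (m≤n⇒m≤1+n ≤-refl)))

fromList : ∀ {n} → List (Fin n) → Subset n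
fromList xs = ⋃ (map ⁅_⁆ xs)

∈-fromList⁺ : ∀ {n} {x : Fin n} {xs} → x ∈ xs → x ∈ˢ fromList xs
∈-fromList⁺ {x = x} (here refl) = x∈p∪q⁺ (inj₁ (x∈⁅x⁆ x))
∈-fromList⁺ (there x∈xs)        = x∈p∪q⁺ (inj₂ (∈-fromList⁺ x∈xs))

∈-fromList⁻ : ∀ {n} {x : Fin n} xs → x ∈ˢ fromList xs → x ∈ xs
∈-fromList⁻ []       x∈ = ⊥-elim (∉⊥ x∈)
∈-fromList⁻ (y ∷ xs) x∈ =
  [ here ∘ x∈⁅y⁆⇒x≡y y , there ∘ ∈-fromList⁻ xs ]′ (x∈p∪q⁻ ⁅ y ⁆ (fromList xs) x∈)

∣fromList∣≤length : ∀ {n} (xs : List (Fin n)) → ∣ fromList xs ∣ ≤ length xs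
∣fromList∣≤length {n} []   = ≤-reflexive (∣⊥∣≡0 n)
∣fromList∣≤length (x ∷ xs) =
  ≤-trans (∣p∪q∣≤∣p∣+∣q∣ ⁅ x ⁆ (fromList xs))
          (subst (λ k → k + _ ≤ _) (sym (∣⁅x⁆∣≡1 x)) (s≤s (∣fromList∣≤length xs)))

∈⇒↭ : ∀ {A : Set} {x : A} {xs} → x ∈ xs → ∃ λ ys → xs ↭ x ∷ ys
∈⇒↭ x∈xs with ys , zs , refl ← ∈-∃++ x∈xs = ys ++ zs , shift _ ys zs

module _ {n : ℕ} (G : Digraph n) where
  open Digraph G

  private
    V = Fin n

  -- Topological order of an acyclic digraph.

  Precedes : V → V → Set
  Precedes a b = arc b a ≡ false

  -- By acyclicity the transitive closure of the arcs is a strict partial order, well-founded since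
  -- `V` is finite; the arcs inherit this.
  acyclic⇒wellFounded : Acyclic G → WellFounded (_⟶_ G)
  acyclic⇒wellFounded acyclic = Plus.wellFounded⁻ _ (spo-wellFounded isSPO)
    where
    isSPO : IsStrictPartialOrder _≡_ (TransClosure (_⟶_ G))
    isSPO = record
      { isEquivalence = isEquivalence
      ; irrefl        = λ { refl → acyclic _ }
      ; trans         = Plus._++_
      ; <-resp-≈      = resp₂ _
      }

  -- Walk backwards along arcs inside `xs`; accessibility makes the walk stop.
  source-of : ∀ {v} → Acc (_⟶_ G) v → ∀ xs → v ∈ xs →
              ∃ λ x → x ∈ xs × All (Precedes x) xs
  source-of {v} (acc rec) xs v∈xs with any? (λ w → arc w v ≟ true) xs
  ... | no  none = v , v∈xs , All.map ¬-not (¬Any⇒All¬ xs none)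
  ... | yes some with w , w∈xs , w⟶v ← find some = source-of (rec w⟶v) xs w∈xs

  topologicalSort : WellFounded (_⟶_ G) → ∀ xs →
                    ∃ λ L → xs ↭ L × AllPairs Precedes L
  topologicalSort wf xs = go (length xs) xs refl
    where
    -- Recursion on the length, because `ys` below is no syntactic part of the list it came from.
    go : ∀ k xs → length xs ≡ k → ∃ λ L → xs ↭ L × AllPairs Precedes L
    go zero    []       _  = [] , ↭-refl , []
    go (suc k) (v ∷ vs) eq
      with x , x∈xs , x-first ← source-of (wf v) (v ∷ vs) (here refl)
      with ys , xs↭ ← ∈⇒↭ x∈xs
      with L , ys↭L , sorted ← go k ys (suc-injective (trans (sym (↭-length xs↭)) eq))
      = x ∷ L
      , ↭-trans xs↭ (prep x ys↭L)
      , All.tabulate (λ y∈L →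
          All.lookup x-first (∈-resp-↭ (↭-sym xs↭) (there (∈-resp-↭ (↭-sym ys↭L) y∈L))))
        ∷ sorted

  -- In-traces on lists of vertices.

  Agree : List V → V → V → Set
  Agree W u v = All (λ w → arc w u ≡ arc w v) W

  agree? : ∀ W u v → Dec (Agree W u v)
  agree? W u v = all? (λ w → arc w u ≟ arc w v) W

  agree-refl : ∀ {W u} → Agree W u u
  agree-refl = All.tabulate (λ _ → refl)

  agree-sym : ∀ {W u v} → Agree W u v → Agree W v u
  agree-sym = All.map sym

  agree-trans : ∀ {W u v w} → Agree W u v → Agree W v w → Agree W u w
  agree-trans p q = All.zipWith (λ (a , b) → trans a b) (p , q)

  -- Both traces on `W` are empty.
  before-agree : ∀ {W u v} → All (Precedes u) W → All (Precedes v) W → Agree W u v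
  before-agree p q = All.zipWith (λ (a , b) → trans a (sym b)) (p , q)

  Distinguishes : List V → List V → Set
  Distinguishes W U = ∀ {u v} → u ∈ U → v ∈ U → Agree W u v → u ≡ v

  -- Listing the source s among the vertices to be distinguished makes every
  -- vertex of U outside W dominated.
  distinguishes⇒γL≤ : ∀ {s} W U → (∀ w → arc w s ≡ false) → s ∈ W → s ∈ U →
                      (∀ v → v ∈ W ⊎ v ∈ U) → Distinguishes W U → γL≤ G (length W)
  distinguishes⇒γL≤ {s} W U s-source s∈W s∈U cover dist =
    fromList W , (dominating , locating) , ∣fromList∣≤length W
    where
    outside∈U : ∀ {v} → v ∉ˢ fromList W → v ∈ U
    outside∈U {v} v∉ = [ (λ v∈W → contradiction (∈-fromList⁺ v∈W) v∉) , (λ v∈U → v∈U) ]′ (cover v)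

    dominating : Dominating G (fromList W)
    dominating v v∉ with any? (λ w → arc w v ≟ true) W
    ... | yes some with w , w∈W , w⟶v ← find some = w , ∈-fromList⁺ w∈W , w⟶v
    ... | no  none = contradiction (subst (_∈ˢ _) s≡v (∈-fromList⁺ s∈W)) v∉
      where
      s≡v : s ≡ v
      s≡v = dist s∈U (outside∈U v∉)
              (All.map (λ w↛v → trans (s-source _) (sym (¬-not w↛v))) (¬Any⇒All¬ W none))

    locating : ∀ u v → u ∉ˢ fromList W → v ∉ˢ fromList W → u ≢ v →
               ¬ SameInTrace G (fromList W) u v
    locating u v u∉ v∉ u≢v same =
      u≢v (dist (outside∈U u∉) (outside∈U v∉)
                (All.tabulate (λ w∈W → ⇔→≡ (same _ (∈-fromList⁺ w∈W)))))

  -- The backward scan.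

  module Scan (s t : V)
              (s-source : ∀ w → arc w s ≡ false)
              (s⟶t : arc s t ≡ true)
              where

    -- `Q` holds the scanned vertices in neither `D` nor `R`. `extends` prepares the use of
    -- twin-freeness: outside `D`, the trace on `s ∷ D` already determines the trace on everything
    -- scanned.
    record State (zs : List V) : Set where
      field
        D R Q     : List V
        partition : zs ↭ D ++ R ++ Q
        balanced  : length D ≡ length R
        distinct  : Distinguishes (s ∷ D) (s ∷ t ∷ R)
        extends   : ∀ {u v} → u ∈ s ∷ t ∷ R ++ Q → v ∈ s ∷ t ∷ R ++ Q →
                    Agree (s ∷ D) u v → Agree zs u v

    initial : State []
    initial = record
      { D = [] ; R = [] ; Q = []
      ; partition = ↭-refl
      ; balanced  = refl
      ; distinct  = distinct
      ; extends   = λ _ _ _ → []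
      }
      where
      s≁t : ¬ Agree (s ∷ []) s t
      s≁t (eq ∷ []) with () ← trans (sym (s-source s)) (trans eq s⟶t)

      distinct : Distinguishes (s ∷ []) (s ∷ t ∷ [])
      distinct (here refl)         (here refl)         _   = refl
      distinct (here refl)         (there (here refl)) s~t = contradiction s~t s≁t
      distinct (there (here refl)) (here refl)         t~s = contradiction (agree-sym t~s) s≁t
      distinct (there (here refl)) (there (here refl)) _   = refl

    -- If adding `x` to `D` gives some `v` in `Q` a trace that no representative has, `x` joins `D`
    -- and `v` moves to `R`. If not, `x` goes to `Q`, and the arcs from `x` are already determined
    -- by the traces on `s ∷ D`.
    step : ∀ {x zs} → All (Precedes t) (x ∷ zs) → All (Precedes x) zs →
           State zs → State (x ∷ zs)
    step {x} {zs} t-before x-before st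
      with any? (λ v → ¬? (any? (λ r → agree? (x ∷ s ∷ D) r v) (s ∷ t ∷ R))) Q
      where open State st
    ... | yes some
      with v , v∈Q , v-new ← find some
      with Q′ , Q↭ ← ∈⇒↭ v∈Q
      = record
      { D = x ∷ D ; R = v ∷ R ; Q = Q′
      ; partition = prep x (↭-trans partition (++⁺ˡ D R++Q↭))
      ; balanced  = cong suc balanced
      ; distinct  = λ u∈ v∈ u~v → distinct′ (old-rep u∈) (old-rep v∈) (front u~v)
      -- Agreement at `x` is now part of the hypothesis; the rest is the old invariant.
      ; extends   = λ u∈ v∈ u~v → All.head (front u~v) ∷ extends (old u∈) (old v∈) (All.tail (front u~v))
      }
      where
      open State st

      R++Q↭ : R ++ Q ↭ v ∷ R ++ Q′
      R++Q↭ = ↭-trans (++⁺ˡ R Q↭) (shift v R Q′)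

      old : ∀ {u} → u ∈ s ∷ t ∷ v ∷ R ++ Q′ → u ∈ s ∷ t ∷ R ++ Q
      old = ∈-resp-↭ (prep s (prep t (↭-sym R++Q↭)))

      front : ∀ {u w} → Agree (s ∷ x ∷ D) u w → Agree (x ∷ s ∷ D) u w
      front (a ∷ b ∷ c) = b ∷ a ∷ c

      old-rep : ∀ {u} → u ∈ s ∷ t ∷ v ∷ R → u ≡ v ⊎ u ∈ s ∷ t ∷ R
      old-rep (here eq)                 = inj₂ (here eq)
      old-rep (there (here eq))         = inj₂ (there (here eq))
      old-rep (there (there (here eq))) = inj₁ eq
      old-rep (there (there (there u∈R))) = inj₂ (there (there u∈R))

      distinct′ : ∀ {u w} → u ≡ v ⊎ u ∈ s ∷ t ∷ R → w ≡ v ⊎ w ∈ s ∷ t ∷ R →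
                  Agree (x ∷ s ∷ D) u w → u ≡ w
      distinct′ (inj₁ refl) (inj₁ refl) _   = refl
      distinct′ (inj₁ refl) (inj₂ w∈)   v~w = contradiction (lose w∈ (agree-sym v~w)) v-new
      distinct′ (inj₂ u∈)   (inj₁ refl) u~v = contradiction (lose u∈ u~v) v-new
      distinct′ (inj₂ u∈)   (inj₂ w∈)   u~w = distinct u∈ w∈ (All.tail u~w)
    ... | no none
      = record
      { D = D ; R = R ; Q = x ∷ Q
      ; partition = ↭-trans (prep x partition)
                      (↭-trans (↭-sym (shift x D (R ++ Q))) (++⁺ˡ D (↭-sym (shift x R Q))))
      ; balanced  = balanced
      ; distinct  = distinct
      ; extends   = λ u∈ v∈ → extends′ (old-or-x u∈) (old-or-x v∈)
      }
      where
      open State st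

      -- The failed search means that no vertex of `Q` has a new trace on `x ∷ s ∷ D`.
      rep : ∀ {u} → u ∈ s ∷ t ∷ R ++ Q → ∃ λ r → r ∈ s ∷ t ∷ R × Agree (x ∷ s ∷ D) r u
      rep {u} u∈ with ∈-++⁻ (s ∷ t ∷ R) u∈
      ... | inj₁ u∈R = u , u∈R , agree-refl
      ... | inj₂ u∈Q = find (decidable-stable (any? (λ r → agree? (x ∷ s ∷ D) r u) (s ∷ t ∷ R))
                                              (All.lookup (¬Any⇒All¬ Q none) u∈Q))

      -- The representatives of `u` and `v` agree on `s ∷ D`, so they coincide by `distinct`. Their
      -- common value decides the arc from `x` to both `u` and `v`.
      extends-old : ∀ {u v} → u ∈ s ∷ t ∷ R ++ Q → v ∈ s ∷ t ∷ R ++ Q →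
                    Agree (s ∷ D) u v → Agree (x ∷ zs) u v
      extends-old u∈ v∈ u~v
        with r  , r∈  , xr~xu ∷ r~u   ← rep u∈
        with r′ , r′∈ , xr′~xv ∷ r′~v ← rep v∈
        with refl ← distinct r∈ r′∈ (agree-trans r~u (agree-trans u~v (agree-sym r′~v)))
        = trans (sym xr~xu) xr′~xv ∷ extends u∈ v∈ u~v

      D⊆zs : ∀ {w} → w ∈ D → w ∈ zs
      D⊆zs w∈D = ∈-resp-↭ (↭-sym partition) (∈-++⁺ˡ w∈D)

      x-first : All (Precedes x) (x ∷ zs)
      x-first = ¬-not (loopless x) ∷ x-before

      s-first : All (Precedes s) (x ∷ zs)
      s-first = All.tabulate (λ _ → s-source _)

      restrict : ∀ {u v} → Agree (x ∷ zs) u v → Agree D u v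
      restrict u~v = All.tabulate (λ w∈D → All.lookup u~v (there (D⊆zs w∈D)))

      -- No vertex of x ∷ zs has an arc to x, s or t, so x looks like s or t
      -- according to the arc from s.
      x-like : ∃ λ a → a ∈ s ∷ t ∷ R ++ Q × Agree (s ∷ D) a x × Agree (x ∷ zs) a x
      x-like with arc s x in s?x
      ... | false = s , here refl
                  , trans (s-source s) (sym s?x) ∷ restrict s~x , s~x
        where s~x = before-agree s-first x-first
      ... | true  = t , there (here refl)
                  , trans s⟶t (sym s?x) ∷ restrict t~x , t~x
        where t~x = before-agree t-before x-first

      old-or-x : ∀ {u} → u ∈ s ∷ t ∷ R ++ x ∷ Q → u ∈ x ∷ s ∷ t ∷ R ++ Q
      old-or-x = ∈-resp-↭ (shift x (s ∷ t ∷ R) Q)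

      -- Replace `x` by whichever of `s` and `t` it resembles, which reduces to the old vertices.
      extends-x : ∀ {v} → v ∈ s ∷ t ∷ R ++ Q → Agree (s ∷ D) x v → Agree (x ∷ zs) x v
      extends-x v∈ x~v with a , a∈ , a~x , a≈x ← x-like =
        agree-trans (agree-sym a≈x) (extends-old a∈ v∈ (agree-trans a~x x~v))

      extends′ : ∀ {u v} → u ∈ x ∷ s ∷ t ∷ R ++ Q → v ∈ x ∷ s ∷ t ∷ R ++ Q →
                 Agree (s ∷ D) u v → Agree (x ∷ zs) u v
      extends′ (here refl) (here refl) _   = agree-refl
      extends′ (here refl) (there v∈)  x~v = extends-x v∈ x~v
      extends′ (there u∈)  (here refl) u~x = agree-sym (extends-x u∈ (agree-sym u~x))
      extends′ (there u∈)  (there v∈)  u~v = extends-old u∈ v∈ u~v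

    -- The recursion treats the tail first, so each `x` meets only later vertices, none of which has
    -- an arc to it.
    scan : ∀ {zs} → All (Precedes t) zs → AllPairs Precedes zs → State zs
    scan []       []       = initial
    scan (t< ∷ t<s) (x< ∷ sorted) = step (t< ∷ t<s) x< (scan t<s sorted)

  -- Twin-freeness and the count.

  agree-all⇒sameOpenIn : ∀ {W u v} → (∀ w → w ∈ W) → Agree W u v → SameOpenIn G u v
  agree-all⇒sameOpenIn all∈ u~v w = mk⇔ (trans (sym eq)) (trans eq)
    where eq = All.lookup u~v (all∈ w)

  twinFree⇒agree-injective : TwinFree G → ∀ {W} → (∀ w → w ∈ W) → ∀ {u v} → Agree W u v → u ≡ v
  twinFree⇒agree-injective twinFree all∈ {u} {v} u~v =
    decidable-stable (u ≟ᶠ v) (λ u≢v → twinFree u v u≢v (inj₁ (agree-all⇒sameOpenIn all∈ u~v)))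

  γL≤-mono : ∀ {j k} → j ≤ k → γL≤ G j → γL≤ G k
  γL≤-mono j≤k (D , ld , ∣D∣≤j) = D , ld , ≤-trans ∣D∣≤j j≤k

  -- The scan needs both `s` and `t`, so orders zero and one are settled directly.
  γL≤-sorted : TwinFree G → ∀ L → (∀ v → v ∈ L) → Unique L → AllPairs Precedes L →
               γL≤ G ⌈ length L /2⌉
  γL≤-sorted twinFree [] all∈ _ _ =
    fromList [] , ((λ v → absurd v) , (λ v → absurd v)) , ∣fromList∣≤length {n} []
    where
    absurd : ∀ {A : Set} → V → A
    absurd v with () ← all∈ v
  γL≤-sorted twinFree (s ∷ []) all∈ _ _ =
    distinguishes⇒γL≤ (s ∷ []) (s ∷ []) s-source (here refl) (here refl) (inj₁ ∘ all∈)
      (λ { (here refl) (here refl) _ → refl })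
    where
    s-source : ∀ w → arc w s ≡ false
    s-source w with here refl ← all∈ w = ¬-not (loopless s)
  γL≤-sorted twinFree (s ∷ t ∷ ys) all∈ ((s≢t ∷ _) ∷ _) ((s<t ∷ s<ys) ∷ t<ys ∷ sorted) =
    finish (scan t<ys sorted)
    where
    s-first : All (Precedes s) (s ∷ t ∷ ys)
    s-first = ¬-not (loopless s) ∷ s<t ∷ s<ys

    s-source : ∀ w → arc w s ≡ false
    s-source w = All.lookup s-first (all∈ w)

    injective : ∀ {u v} → Agree (s ∷ t ∷ ys) u v → u ≡ v
    injective = twinFree⇒agree-injective twinFree all∈

    s⟶t : arc s t ≡ true
    s⟶t with arc s t in s?t
    ... | true  = refl
    -- Without this arc `t` would be a second source, with the same empty in-neighbourhood as `s`.
    ... | false = contradiction (injective (before-agree s-first t-first)) s≢t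
      where
      t-first : All (Precedes t) (s ∷ t ∷ ys)
      t-first = s?t ∷ ¬-not (loopless t) ∷ t<ys

    open Scan s t s-source s⟶t

    -- The pair `s`, `t` contributes the `suc`, since halving turns two vertices into one.
    finish : State ys → γL≤ G (suc ⌈ length ys /2⌉)
    finish st = choose Q refl
      where
      open State st

      d = length D

      size : length ys ≡ d + d + length Q
      size = begin
        length ys                      ≡⟨ ↭-length partition ⟩
        length (D ++ R ++ Q)           ≡⟨ length-++ D ⟩
        d + length (R ++ Q)            ≡⟨ cong (d +_) (length-++ R) ⟩
        d + (length R + length Q)      ≡⟨ cong (λ r → d + (r + length Q)) balanced ⟨
        d + (d + length Q)             ≡⟨ +-assoc d d (length Q) ⟨
        d + d + length Q               ∎
        where open ≡-Reasoning

      covered : ∀ v → v ∈ s ∷ D ⊎ v ∈ s ∷ t ∷ R ++ Q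
      covered v with all∈ v
      ... | here v≡s           = inj₁ (here v≡s)
      ... | there (here v≡t)   = inj₂ (there (here v≡t))
      ... | there (there v∈ys) =
        Sum.map there (there ∘ there) (∈-++⁻ D (∈-resp-↭ partition v∈ys))

      choose : ∀ Q′ → Q ≡ Q′ → γL≤ G (suc ⌈ length ys /2⌉)
      -- Here `length ys` is `d + d`, so the bound is `suc d`, the size of `s ∷ D`. All other
      -- vertices lie in `t ∷ R`, where `distinct` applies.
      choose [] Q≡ = γL≤-mono (s≤s d≤)
        (distinguishes⇒γL≤ (s ∷ D) (s ∷ t ∷ R) s-source (here refl) (here refl)
          (subst (λ U → ∀ v → v ∈ s ∷ D ⊎ v ∈ s ∷ t ∷ U)
            (trans (cong (R ++_) Q≡) (++-identityʳ R)) covered) distinct)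
        where
        d≤ : d ≤ ⌈ length ys /2⌉
        d≤ = ≤-trans (≤-reflexive (n≡⌈n+n/2⌉ d))
               (⌈n/2⌉-mono (≤-trans (m≤m+n (d + d) _) (≤-reflexive (sym size))))
      choose (_ ∷ Q′) Q≡ = γL≤-mono (s≤s d<)
        (distinguishes⇒γL≤ (t ∷ s ∷ D) (s ∷ t ∷ R ++ Q) s-source (there (here refl)) (here refl)
          (Sum.map₁ there ∘ covered)
          -- Agreement at `s`, at `t` and, by `extends`, on `ys` is agreement everywhere.
          (λ { u∈ v∈ (t~ ∷ s~D) → injective (All.head s~D ∷ t~ ∷ extends u∈ v∈ s~D) }))
        where
        d< : suc d ≤ ⌈ length ys /2⌉
        -- An element of `Q` makes `length ys` at least `suc (d + d)`, whose half rounds up to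
        -- `suc d`; the rounding pays for `t`.
        d< = ≤-trans (s≤s (≤-reflexive (n≡⌊n+n/2⌋ d)))
               (⌈n/2⌉-mono (≤-trans (m≤m+n (suc (d + d)) (length Q′))
                 (≤-reflexive (sym size-suc))))
          where
          size-suc : length ys ≡ suc (d + d + length Q′)
          size-suc = trans size (trans (cong (λ q → d + d + length q) Q≡) (+-suc (d + d) _))

theorem16 : (n : ℕ) (G : Digraph n) → Acyclic G → TwinFree G → γL≤ G ⌈ n /2⌉
theorem16 n G acyclic twinFree
  with L , all↭L , sorted ← topologicalSort G (acyclic⇒wellFounded G acyclic) (allFin n) =
  subst (λ k → γL≤ G ⌈ k /2⌉) (trans (sym (↭-length all↭L)) (length-tabulate (λ i → i)))
    (γL≤-sorted G twinFree L (λ v → ∈-resp-↭ all↭L (∈-allFin v))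
      (↭ₛ.Unique-resp-↭ (setoid (Fin n)) (↭⇒↭ₛ all↭L) (allFin⁺ n)) sorted)
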